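{- A finite group $G$ is code-perfect if and only if $G$ has no elements of order $4$.
   Context: All groups are finite; $e$ denotes the identity. For a group $G$ and an inverse-closed subset $S\subseteq G$ with $e\notin S$, the Cayley graph $\mathrm{Cay}(G,S)$ has vertex set $G$, with distinct $x,y$ adjacent iff $yx^{ -1}\in S$. A subset $C$ of the vertex set of a graph $\Gamma$ is a perfect code in $\Gamma$ if $C$ is an independent set and every vertex outside $C$ is adjacent to exactly one vertex of $C$. A subset $C$ of a group $G$ is a perfect code of $G$ if there is a Cayley graph $\mathrm{Cay}(G,S)$ in which $C$ is a perfect code. A group $G$ is code-perfect if every proper subgroup of $G$ is a perfect code of $G$ (equivalently, every subgroup is). -}

module Defs where

open import Level using (0ℓ)
open import Algebra.Bundles using (Group)
open import Data.Nat using (ℕ; zero; suc; _≤_; _<_)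
open import Data.Fin using (Fin)
open import Data.Bool using (Bool; true; false)
open import Data.Product using (Σ; _×_; ∃-syntax; proj₁)
open import Relation.Nullary using (¬_)
open import Relation.Binary.PropositionalEquality as ≡ using (_≡_)
open import Function.Bundles using (Inverse)

Finite : Group 0ℓ 0ℓ → Set
Finite G = Σ ℕ λ n → Inverse (Group.setoid G) (≡.setoid (Fin n))

module _ (G : Group 0ℓ 0ℓ) where
  open Group G

  Subset : Set
  Subset = Σ (Carrier → Bool) λ χ → ∀ {x y} → x ≈ y → χ x ≡ χ y

  _∈_ : Carrier → Subset → Set
  x ∈ A = proj₁ A x ≡ true

  _∉_ : Carrier → Subset → Set
  x ∉ A = ¬ (x ∈ A)

  pow : Carrier → ℕ → Carrier
  pow g zero    = ε
  pow g (suc n) = g ∙ pow g n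

  HasOrder : Carrier → ℕ → Set
  HasOrder g n = pow g n ≈ ε × (∀ k → 1 ≤ k → k < n → ¬ (pow g k ≈ ε))

  IsSubgroup : Subset → Set
  IsSubgroup H = (ε ∈ H)
               × (∀ x y → x ∈ H → y ∈ H → (x ∙ y) ∈ H)
               × (∀ x → x ∈ H → (x ⁻¹) ∈ H)

  IsConnectionSet : Subset → Set
  IsConnectionSet S = (∀ s → s ∈ S → (s ⁻¹) ∈ S) × (ε ∉ S)

  -- adjacency in Cay(G,S): distinct x,y with y x⁻¹ ∈ S
  Adj : Subset → Carrier → Carrier → Set
  Adj S x y = ¬ (x ≈ y) × ((y ∙ (x ⁻¹)) ∈ S)

  IsPerfectCodeIn : Subset → Subset → Set
  IsPerfectCodeIn S C =
      (∀ x y → x ∈ C → y ∈ C → ¬ Adj S x y)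
    × (∀ v → v ∉ C →
         ∃[ c ] (c ∈ C × Adj S v c × (∀ c′ → c′ ∈ C → Adj S v c′ → c′ ≈ c)))

  IsPerfectCodeOf : Subset → Set
  IsPerfectCodeOf C = ∃[ S ] (IsConnectionSet S × IsPerfectCodeIn S C)

  CodePerfect : Set
  CodePerfect = ∀ H → IsSubgroup H → IsPerfectCodeOf H

{-# OPTIONS --safe #-}

-- A subgroup H is a perfect code of G iff some inverse-closed S disjoint from H
-- meets every right coset of H other than H itself in exactly one element.
--
-- If g has order 4 and H = {ε, g²}, then Hg = {g, g⁻¹} is a coset that no
-- inverse-closed set meets exactly once.
--
-- Conversely S is built greedily, covering one missing coset Hv⁻¹ at a time.
-- If HvH = Hv⁻¹H, some x ∈ vH has x² ∈ H; absent elements of order 4, an odd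
-- power of x is an involution, and it still lies in vH.  Otherwise the double
-- cosets HvH and Hv⁻¹H are disjoint, contain equally many cosets of H, and as
-- inversion exchanges S ∩ HvH and S ∩ Hv⁻¹H they are equally covered; so there is
-- a missing coset on the other side too, and some s and s⁻¹ cover both at once.

module Submission where

open import Defs
open import Level using (0ℓ)
open import Algebra.Bundles using (Group)
open import Function.Bundles using (_⇔_; mk⇔; Inverse)
open import Relation.Nullary using (¬_)

import Algebra.Properties.Group as GroupProperties
open import Data.Bool using (true; false)
import Data.Bool.Properties as Bool
open import Data.Fin as Fin using (Fin; toℕ; punchOut)
import Data.Fin.Properties as Fin
open import Data.List using ([]; _∷_; allFin; map)
open import Data.List.Membership.Propositional.Properties using (∈-allFin; ∈-map⁺)
open import Data.List.Relation.Unary.All as All using (All; []; _∷_)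
open import Data.Nat using (ℕ; zero; suc; _+_; _*_; _<_; _≤_; s≤s; z≤n; z<s)
open import Data.Nat.DivMod using (_divMod_; result)
open import Data.Nat.Induction using (Acc; acc; <-wellFounded)
import Data.Nat.Properties as ℕ
open import Data.Product using (∃; ∃-syntax; _×_; _,_; proj₁; proj₂)
open import Data.Sum using (_⊎_; inj₁; inj₂; [_,_]′)
open import Function using (_∘_)
open import Relation.Binary.Definitions using (Decidable; _Respects_)
open import Relation.Binary.PropositionalEquality as ≡ using (_≡_)
import Relation.Binary.Reasoning.Setoid as ≈-Reasoning
open import Relation.Nullary using (Dec; yes; no; does; contradiction)
open import Relation.Nullary.Decidable using (map′; decidable-stable; does-⇔; dec-true; _×-dec_; _⊎-dec_; ¬?)
import Relation.Unary as Unary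

-- A missed value `y` could be punched out of the codomain, leaving an injection from `Fin (suc n)`
-- into `Fin n`.
Fin-injective⇒surjective : ∀ {n} (f : Fin n → Fin n) →
  (∀ {i j} → f i ≡ f j → i ≡ j) → ∀ y → ∃[ i ] f i ≡ y
Fin-injective⇒surjective {suc n} f inj y with Fin.any? (λ i → f i Fin.≟ y)
... | yes hit  = hit
... | no  miss = contradiction (Fin.injective⇒≤ {f = g} g-injective) ℕ.1+n≰n
  where
  y≢f : ∀ i → ¬ y ≡ f i
  y≢f i eq = miss (i , ≡.sym eq)
  g : Fin (suc n) → Fin n
  g i = punchOut (y≢f i)
  g-injective : ∀ {i j} → g i ≡ g j → i ≡ j
  g-injective {i} {j} eq = inj (Fin.punchOut-injective (y≢f i) (y≢f j) eq)

module _ (G : Group 0ℓ 0ℓ) where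
  open Group G
  open GroupProperties G
  open ≈-Reasoning setoid

  private
    infix 4 _∈ᴳ_
    _∈ᴳ_ : Carrier → Subset G → Set
    _∈ᴳ_ = _∈_ G
    infixr 8 _^_
    _^_ : Carrier → ℕ → Carrier
    _^_ = pow G

  -- Boolean-valued subsets and powers in a group

  ∈-resp-≈ : (A : Subset G) → (_∈ᴳ A) Respects _≈_
  ∈-resp-≈ A x≈y x∈A = ≡.trans (≡.sym (proj₂ A x≈y)) x∈A

  ∈-dec : (A : Subset G) → Unary.Decidable (_∈ᴳ A)
  ∈-dec A x = proj₁ A x Bool.≟ true

  module _ {P : Carrier → Set} (P? : Unary.Decidable P) (P-resp : P Respects _≈_) where

    ⟦_⟧ : Subset G
    ⟦_⟧ = (does ∘ P?) , λ {x} {y} x≈y →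
      does-⇔ (mk⇔ (P-resp x≈y) (P-resp (sym x≈y))) (P? x) (P? y)

    ∈⟦⟧⁺ : ∀ {x} → P x → x ∈ᴳ ⟦_⟧
    ∈⟦⟧⁺ {x} = dec-true (P? x)

    ∈⟦⟧⁻ : ∀ {x} → x ∈ᴳ ⟦_⟧ → P x
    ∈⟦⟧⁻ {x} eq with P? x | eq
    ... | yes p | _  = p
    ... | no  _ | ()

  ^-homo-+ : ∀ x m n → x ^ (m + n) ≈ x ^ m ∙ x ^ n
  ^-homo-+ x zero    n = sym (identityˡ _)
  ^-homo-+ x (suc m) n = trans (∙-congˡ (^-homo-+ x m n)) (sym (assoc _ _ _))

  ^-^-assoc : ∀ x m n → x ^ (n * m) ≈ (x ^ m) ^ n
  ^-^-assoc x m zero    = refl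
  ^-^-assoc x m (suc n) = trans (^-homo-+ x m (n * m)) (∙-congˡ (^-^-assoc x m n))

  x^2≈x∙x : ∀ x → x ^ 2 ≈ x ∙ x
  x^2≈x∙x x = ∙-congˡ (identityʳ x)

  -- Used with `x ∙ y` in a subgroup, where it places `x ⁻¹` in the left coset of `y`.
  x⁻¹≈y∙[x∙y]⁻¹ : ∀ x y → x ⁻¹ ≈ y ∙ (x ∙ y) ⁻¹
  x⁻¹≈y∙[x∙y]⁻¹ x y = trans (sym (\\-leftDividesˡ y (x ⁻¹))) (∙-congˡ (sym (⁻¹-anti-homo-∙ x y)))

  HasNoOrder4 : Set
  HasNoOrder4 = ∀ g → ¬ HasOrder G g 4

  -- Finiteness: decidability, surjectivity and exponents

  module _ (fin : Finite G) where
    private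
      n = proj₁ fin
      module E = Inverse (proj₂ fin)

    from∘to : ∀ x → E.from (E.to x) ≈ x
    from∘to = E.strictlyInverseʳ

    to-injective : ∀ {x y} → E.to x ≡ E.to y → x ≈ y
    to-injective {x} {y} eq =
      trans (sym (from∘to x)) (trans (E.from-cong eq) (from∘to y))

    from-injective : ∀ {i j} → E.from i ≈ E.from j → i ≡ j
    from-injective {i} {j} eq = ≡.trans (≡.sym (E.strictlyInverseˡ i))
      (≡.trans (E.to-cong eq) (E.strictlyInverseˡ j))

    _≟_ : Decidable _≈_
    x ≟ y = map′ to-injective E.to-cong (E.to x Fin.≟ E.to y)

    ∃? : {P : Carrier → Set} → P Respects _≈_ → Unary.Decidable P → Dec (∃ P)
    ∃? P-resp P? = map′ (λ (i , p) → E.from i , p)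
      (λ (x , p) → E.to x , P-resp (sym (from∘to x)) p) (Fin.any? (P? ∘ E.from))

    injective⇒surjective : (f : Carrier → Carrier) →
      (∀ {x y} → f x ≈ f y → x ≈ y) → ∀ y → ∃[ x ] f x ≈ y
    injective⇒surjective f inj y
      with i , eq ← Fin-injective⇒surjective (E.to ∘ f ∘ E.from)
                      (from-injective ∘ inj ∘ to-injective) (E.to y)
      = E.from i , to-injective eq

    -- Among the n + 1 powers with exponents 0 to n two agree, and cancelling the one with the
    -- smaller exponent leaves a positive exponent.
    finite-exponent : ∀ x → ∃[ m ] x ^ suc m ≈ ε
    finite-exponent x
      with i , j , i<j , eq ← Fin.pigeonhole (ℕ.n<1+n n) (E.to ∘ (x ^_) ∘ toℕ)
      with m , i+m≡j ← ℕ.m≤n⇒∃[o]m+o≡n i<j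
      = m , identityʳ-unique (x ^ toℕ i) _ (begin
        x ^ toℕ i ∙ x ^ suc m  ≈⟨ ^-homo-+ x (toℕ i) (suc m) ⟨
        x ^ (toℕ i + suc m)    ≡⟨ ≡.cong (x ^_) (≡.trans (ℕ.+-suc (toℕ i) m) i+m≡j) ⟩
        x ^ toℕ j              ≈⟨ to-injective eq ⟨
        x ^ toℕ i              ∎)

    -- Powers in a group without elements of order 4

    module _ (no4 : HasNoOrder4) where

      ^4≈ε⇒^2≈ε : ∀ x → x ^ 4 ≈ ε → x ^ 2 ≈ ε
      ^4≈ε⇒^2≈ε x x^4≈ε with (x ^ 2) ≟ ε
      ... | yes x^2≈ε = x^2≈ε
      ... | no  x^2≉ε = contradiction (x^4≈ε , minimal) (no4 x)
        where
        x≉ε : ¬ x ≈ ε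
        x≉ε x≈ε = x^2≉ε (trans (x^2≈x∙x x) (trans (∙-cong x≈ε x≈ε) (identityˡ ε)))
        minimal : ∀ k → 1 ≤ k → k < 4 → ¬ x ^ k ≈ ε
        minimal 1 _ _ eq = x≉ε (trans (sym (identityʳ x)) eq)
        minimal 2 _ _ eq = x^2≉ε eq
        minimal 3 _ _ eq = x≉ε (begin
          x          ≈⟨ identityʳ x ⟨
          x ∙ ε      ≈⟨ ∙-congˡ eq ⟨
          x ^ 4      ≈⟨ x^4≈ε ⟩
          ε          ∎)
        minimal (suc (suc (suc (suc k)))) _ (s≤s (s≤s (s≤s (s≤s ()))))

      -- Some x^(2m) is ε with m > 0. While m = 2k is even, (x^k)^4 = ε, and the absence of order 4
      -- improves this to x^(2k) = ε; so m can be halved until it is odd.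
      odd-power-squares-to-ε : ∀ x → ∃[ k ] (x ^ suc (k * 2)) ^ 2 ≈ ε
      odd-power-squares-to-ε x with m , eq ← finite-exponent x
        = descend (suc m) (<-wellFounded _) z<s (begin
          x ^ (2 * suc m)    ≈⟨ ^-^-assoc x (suc m) 2 ⟩
          (x ^ suc m) ^ 2    ≈⟨ x^2≈x∙x _ ⟩
          x ^ suc m ∙ x ^ suc m  ≈⟨ ∙-cong eq eq ⟩
          ε ∙ ε              ≈⟨ identityˡ ε ⟩
          ε                  ∎)
        where
        descend : ∀ m → Acc _<_ m → 0 < m → x ^ (2 * m) ≈ ε →
                  ∃[ k ] (x ^ suc (k * 2)) ^ 2 ≈ ε
        descend m (acc rec) 0<m eq with m divMod 2
        ... | result k (Fin.suc Fin.zero) ≡.refl =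
          k , trans (sym (^-^-assoc x (suc (k * 2)) 2)) eq
        ... | result zero Fin.zero ≡.refl = contradiction 0<m λ ()
        ... | result k@(suc _) Fin.zero ≡.refl =
          descend k (rec (ℕ.m<m*n k 2 (s≤s (s≤s z≤n)))) z<s (begin
            x ^ (2 * k)    ≈⟨ ^-^-assoc x k 2 ⟩
            (x ^ k) ^ 2    ≈⟨ ^4≈ε⇒^2≈ε (x ^ k) (begin
              (x ^ k) ^ 4      ≈⟨ ^-^-assoc x k 4 ⟨
              x ^ (4 * k)      ≡⟨ ≡.cong (x ^_) (≡.trans (ℕ.*-assoc 2 2 k)
                                    (≡.cong (2 *_) (ℕ.*-comm 2 k))) ⟩
              x ^ (2 * (k * 2)) ≈⟨ eq ⟩
              ε                ∎) ⟩
            ε              ∎)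

    -- Right cosets of a subgroup and partial transversals

    module _ (H : Subset G) (isSubgroup : IsSubgroup G H) where
      private
        ε∈H = proj₁ isSubgroup
        ∙∈H : ∀ {x y} → x ∈ᴳ H → y ∈ᴳ H → x ∙ y ∈ᴳ H
        ∙∈H = proj₁ (proj₂ isSubgroup) _ _
        ⁻¹∈H : ∀ {x} → x ∈ᴳ H → x ⁻¹ ∈ᴳ H
        ⁻¹∈H = proj₂ (proj₂ isSubgroup) _
        ∈H-resp : (_∈ᴳ H) Respects _≈_
        ∈H-resp = ∈-resp-≈ H

      ∈-cancelʳ : ∀ {x k} → k ∈ᴳ H → x ∙ k ∈ᴳ H → x ∈ᴳ H
      ∈-cancelʳ k∈H xk∈H = ∈H-resp (//-rightDividesʳ _ _) (∙∈H xk∈H (⁻¹∈H k∈H))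

      ∈-cancelˡ : ∀ {x k} → k ∈ᴳ H → k ∙ x ∈ᴳ H → x ∈ᴳ H
      ∈-cancelˡ k∈H kx∈H = ∈H-resp (\\-leftDividesʳ _ _) (∙∈H (⁻¹∈H k∈H) kx∈H)

      ∈-⁻¹-cancel : ∀ {x} → x ⁻¹ ∈ᴳ H → x ∈ᴳ H
      ∈-⁻¹-cancel x⁻¹∈H = ∈H-resp (⁻¹-involutive _) (⁻¹∈H x⁻¹∈H)

      ^∈H : ∀ {x} → x ∈ᴳ H → ∀ m → x ^ m ∈ᴳ H
      ^∈H x∈H zero    = ε∈H
      ^∈H x∈H (suc m) = ∙∈H x∈H (^∈H x∈H m)

      -- Equivalently, `S` meets the right coset Hv⁻¹. For v outside H, `s ∙ v` is then a neighbour
      -- of v in H.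
      Covered : Subset G → Carrier → Set
      Covered S v = ∃[ s ] (s ∈ᴳ S × s ∙ v ∈ᴳ H)

      Covered-resp : ∀ S → Covered S Respects _≈_
      Covered-resp S x≈y (s , s∈S , sx∈H) = s , s∈S , ∈H-resp (∙-congˡ x≈y) sx∈H

      Covered? : ∀ S → Unary.Decidable (Covered S)
      Covered? S v = ∃?
        (λ x≈y (x∈S , xv∈H) → ∈-resp-≈ S x≈y x∈S , ∈H-resp (∙-congʳ x≈y) xv∈H)
        (λ s → ∈-dec S s ×-dec ∈-dec H (s ∙ v))

      -- Replacing v by vk does not change the coset, as H(vk)⁻¹ = Hv⁻¹.
      Covered-∙ : ∀ S {v k} → k ∈ᴳ H → Covered S (v ∙ k) → Covered S v
      Covered-∙ S k∈H (s , s∈S , svk∈H) =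
        s , s∈S , ∈-cancelʳ k∈H (∈H-resp (sym (assoc _ _ _)) svk∈H)

      record IsPartialTransversal (S : Subset G) : Set where
        field
          inverse-closed : ∀ {s} → s ∈ᴳ S → s ⁻¹ ∈ᴳ S
          disjoint       : ∀ {s} → s ∈ᴳ S → ¬ s ∈ᴳ H
          -- As S is inverse-closed, this says that S has at most one element in
          -- each right coset of H.
          unique         : ∀ {s t} → s ∈ᴳ S → t ∈ᴳ S → s ∙ t ∈ᴳ H → s ≈ t ⁻¹

      -- Adjoins s and s⁻¹ to `S`. The freeness hypotheses say that `S` misses Hs⁻¹ and Hs. These
      -- cosets coincide exactly when ss ∈ H, and then `self` makes the two new elements equal.
      module Extend {S : Subset G} (partial : IsPartialTransversal S) {s : Carrier}
        (s∉H : ¬ s ∈ᴳ H) (s-free : ¬ Covered S s) (s⁻¹-free : ¬ Covered S (s ⁻¹))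
        (self : s ∙ s ∈ᴳ H → s ≈ s ⁻¹) where

        open IsPartialTransversal partial

        New : Carrier → Set
        New t = t ≈ s ⊎ t ≈ s ⁻¹

        New-⁻¹ : ∀ {t} → New t → New (t ⁻¹)
        New-⁻¹ (inj₁ t≈s)   = inj₂ (⁻¹-cong t≈s)
        New-⁻¹ (inj₂ t≈s⁻¹) = inj₁ (trans (⁻¹-cong t≈s⁻¹) (⁻¹-involutive s))

        New-∉H : ∀ {t} → New t → ¬ t ∈ᴳ H
        New-∉H (inj₁ t≈s)   t∈H = s∉H (∈H-resp t≈s t∈H)
        New-∉H (inj₂ t≈s⁻¹) t∈H = s∉H (∈-⁻¹-cancel (∈H-resp t≈s⁻¹ t∈H))

        New-free : ∀ {t} → New t → ¬ Covered S t
        New-free (inj₁ t≈s)   = s-free ∘ Covered-resp S t≈s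
        New-free (inj₂ t≈s⁻¹) = s⁻¹-free ∘ Covered-resp S t≈s⁻¹

        New-unique : ∀ {t u} → New t → New u → t ∙ u ∈ᴳ H → t ≈ u ⁻¹
        New-unique (inj₁ t≈s) (inj₁ u≈s) tu∈H =
          trans t≈s (trans (self (∈H-resp (∙-cong t≈s u≈s) tu∈H)) (⁻¹-cong (sym u≈s)))
        New-unique (inj₁ t≈s) (inj₂ u≈s⁻¹) _ =
          trans t≈s (trans (sym (⁻¹-involutive s)) (⁻¹-cong (sym u≈s⁻¹)))
        New-unique (inj₂ t≈s⁻¹) (inj₁ u≈s) _ = trans t≈s⁻¹ (⁻¹-cong (sym u≈s))
        New-unique (inj₂ t≈s⁻¹) (inj₂ u≈s⁻¹) tu∈H = begin
          _          ≈⟨ t≈s⁻¹ ⟩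
          s ⁻¹       ≈⟨ self (∈-⁻¹-cancel (∈H-resp
                          (trans (∙-cong t≈s⁻¹ u≈s⁻¹) (sym (⁻¹-anti-homo-∙ s s))) tu∈H)) ⟨
          s          ≈⟨ ⁻¹-involutive s ⟨
          s ⁻¹ ⁻¹    ≈⟨ ⁻¹-cong u≈s⁻¹ ⟨
          _          ∎

        S⁺-dec : Unary.Decidable (λ t → t ∈ᴳ S ⊎ New t)
        S⁺-dec t = ∈-dec S t ⊎-dec (t ≟ s) ⊎-dec (t ≟ (s ⁻¹))

        S⁺-resp : (λ t → t ∈ᴳ S ⊎ New t) Respects _≈_
        S⁺-resp x≈y (inj₁ x∈S)          = inj₁ (∈-resp-≈ S x≈y x∈S)
        S⁺-resp x≈y (inj₂ (inj₁ x≈s))   = inj₂ (inj₁ (trans (sym x≈y) x≈s))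
        S⁺-resp x≈y (inj₂ (inj₂ x≈s⁻¹)) = inj₂ (inj₂ (trans (sym x≈y) x≈s⁻¹))

        S⁺ : Subset G
        S⁺ = ⟦ S⁺-dec ⟧ S⁺-resp

        S⁺-intro : ∀ {t} → t ∈ᴳ S ⊎ New t → t ∈ᴳ S⁺
        S⁺-intro = ∈⟦⟧⁺ S⁺-dec S⁺-resp

        S⁺-elim : ∀ {t} → t ∈ᴳ S⁺ → t ∈ᴳ S ⊎ New t
        S⁺-elim = ∈⟦⟧⁻ S⁺-dec S⁺-resp

        Covered-mono : ∀ {v} → Covered S v → Covered S⁺ v
        Covered-mono (t , t∈S , tv∈H) = t , S⁺-intro (inj₁ t∈S) , tv∈H

        S⁺-partial : IsPartialTransversal S⁺
        S⁺-partial = record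
          { inverse-closed = λ s∈ → S⁺-intro (inv (S⁺-elim s∈))
          ; disjoint       = λ s∈ → dis (S⁺-elim s∈)
          ; unique         = λ s∈ t∈ → uni (S⁺-elim s∈) (S⁺-elim t∈)
          }
          where
          inv : ∀ {t} → t ∈ᴳ S ⊎ New t → t ⁻¹ ∈ᴳ S ⊎ New (t ⁻¹)
          inv (inj₁ t∈S) = inj₁ (inverse-closed t∈S)
          inv (inj₂ new) = inj₂ (New-⁻¹ new)
          dis : ∀ {t} → t ∈ᴳ S ⊎ New t → ¬ t ∈ᴳ H
          dis (inj₁ t∈S) = disjoint t∈S
          dis (inj₂ new) = New-∉H new
          uni : ∀ {t u} → t ∈ᴳ S ⊎ New t → u ∈ᴳ S ⊎ New u → t ∙ u ∈ᴳ H → t ≈ u ⁻¹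
          uni (inj₁ t∈S) (inj₁ u∈S) tu∈H = unique t∈S u∈S tu∈H
          uni (inj₁ t∈S) (inj₂ new) tu∈H = contradiction (_ , t∈S , tu∈H) (New-free new)
          -- Inverting tu turns this into u⁻¹ ∈ S covering t⁻¹, which is a new element too.
          uni (inj₂ new) (inj₁ u∈S) tu∈H = contradiction
            (_ , inverse-closed u∈S , ∈H-resp (⁻¹-anti-homo-∙ _ _) (⁻¹∈H tu∈H))
            (New-free (New-⁻¹ new))
          uni (inj₂ new) (inj₂ new′) tu∈H = New-unique new new′ tu∈H

      -- Linked v u says that u ∈ Hv⁻¹H.
      Linked : Carrier → Carrier → Set
      Linked v u = ∃[ h ] (h ∈ᴳ H × (v ∙ h) ∙ u ∈ᴳ H)

      Linked? : Decidable Linked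
      Linked? v u = ∃?
        (λ x≈y (x∈H , vxu∈H) → ∈H-resp x≈y x∈H , ∈H-resp (∙-congʳ (∙-congˡ x≈y)) vxu∈H)
        (λ h → ∈-dec H h ×-dec ∈-dec H ((v ∙ h) ∙ u))

      Linked-resp : ∀ {v} → Linked v Respects _≈_
      Linked-resp x≈y (h , h∈H , vhx∈H) = h , h∈H , ∈H-resp (∙-congˡ x≈y) vhx∈H

      Linked-⁻¹ : ∀ v → Linked v (v ⁻¹)
      Linked-⁻¹ v = ε , ε∈H ,
        ∈H-resp (sym (trans (∙-congʳ (identityʳ v)) (inverseʳ v))) ε∈H

      -- Comparing the cosets covered in HvH and in Hv⁻¹H

      module Counting {S : Subset G} (partial : IsPartialTransversal S) (v : Carrier)
        (covered : ∀ u → Linked v u → Covered S u) where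

        open IsPartialTransversal partial

        -- On Hv⁻¹H this sends s⁻¹k, with s ∈ S and k ∈ H, to (sk)⁻¹.
        swap′ : ∀ u → Dec (Linked v u) → Carrier
        swap′ u (yes l) = let s = proj₁ (covered u l) in (s ∙ (s ∙ u)) ⁻¹
        swap′ u (no  _) = u

        -- Being the identity outside Hv⁻¹H, this is a self-map of the whole carrier, so
        -- `injective⇒surjective` applies and no cosets need be counted. The decision is a separate
        -- argument of `swap′` so that proofs can split on it.
        swap : Carrier → Carrier
        swap u = swap′ u (Linked? v u)

        swap′-Linked : ∀ u (l : Linked v u) → Linked v (swap′ u (yes l))
        swap′-Linked u l@(h , h∈H , vhu∈H) with s , _ , k∈H ← covered u l
          -- The extra factor k cancels the k⁻¹ in (sk)⁻¹ = k⁻¹s⁻¹, and the remaining s⁻¹ is uk⁻¹.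
          = h ∙ k , ∙∈H h∈H k∈H , ∈H-resp (sym eq) (∙∈H vhu∈H (⁻¹∈H k∈H))
          where
          k = s ∙ u
          eq : (v ∙ (h ∙ k)) ∙ (s ∙ k) ⁻¹ ≈ ((v ∙ h) ∙ u) ∙ k ⁻¹
          eq = begin
            (v ∙ (h ∙ k)) ∙ (s ∙ k) ⁻¹          ≈⟨ ∙-cong (sym (assoc v h k)) (⁻¹-anti-homo-∙ s k) ⟩
            ((v ∙ h) ∙ k) ∙ (k ⁻¹ ∙ s ⁻¹)       ≈⟨ assoc _ _ _ ⟩
            (v ∙ h) ∙ (k ∙ (k ⁻¹ ∙ s ⁻¹))       ≈⟨ ∙-congˡ (\\-leftDividesˡ k (s ⁻¹)) ⟩
            (v ∙ h) ∙ s ⁻¹                      ≈⟨ ∙-congˡ (x⁻¹≈y∙[x∙y]⁻¹ s u) ⟩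
            (v ∙ h) ∙ (u ∙ k ⁻¹)                ≈⟨ assoc _ _ _ ⟨
            ((v ∙ h) ∙ u) ∙ k ⁻¹                ∎

        -- The mixed cases fail because linked elements have linked images. If both are linked,
        -- s(sx) = t(ty) with sx and ty in H, so sH = tH; uniqueness for s⁻¹ and t gives s = t,
        -- which cancels.
        swap′-injective : ∀ x y (dx : Dec (Linked v x)) (dy : Dec (Linked v y)) →
                          swap′ x dx ≈ swap′ y dy → x ≈ y
        swap′-injective x y (no _)  (no _)  eq = eq
        swap′-injective x y (yes l) (no ¬l) eq =
          contradiction (Linked-resp eq (swap′-Linked x l)) ¬l
        swap′-injective x y (no ¬l) (yes l) eq =
          contradiction (Linked-resp (sym eq) (swap′-Linked y l)) ¬l
        swap′-injective x y (yes l) (yes l′) eq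
          with s , s∈S , sx∈H ← covered x l
          with t , t∈S , ty∈H ← covered y l′
          = ∙-cancelˡ s x y (∙-cancelˡ s _ _ (trans ssx≈tty (sym (∙-cong s≈t (∙-congʳ s≈t)))))
          where
          ssx≈tty : s ∙ (s ∙ x) ≈ t ∙ (t ∙ y)
          ssx≈tty = ⁻¹-injective eq
          s⁻¹t∈H : s ⁻¹ ∙ t ∈ᴳ H
          s⁻¹t∈H = ∈-cancelʳ ty∈H (∈H-resp (begin
            s ∙ x                   ≈⟨ \\-leftDividesʳ s (s ∙ x) ⟨
            s ⁻¹ ∙ (s ∙ (s ∙ x))    ≈⟨ ∙-congˡ ssx≈tty ⟩
            s ⁻¹ ∙ (t ∙ (t ∙ y))    ≈⟨ assoc _ _ _ ⟨
            (s ⁻¹ ∙ t) ∙ (t ∙ y)    ∎) sx∈H)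
          s≈t : s ≈ t
          s≈t = ⁻¹-injective (unique (inverse-closed s∈S) t∈S s⁻¹t∈H)

        -- By surjectivity v⁻¹ is the image of some u. Unlinked elements are fixed and v⁻¹ is
        -- linked, so u is linked; hence v = sk with s ∈ S and k ∈ H, and s⁻¹ covers v.
        base-covered : Covered S v
        base-covered
          with u , eq ← injective⇒surjective swap
                 (swap′-injective _ _ (Linked? v _) (Linked? v _)) (v ⁻¹)
          with Linked? v u
        ... | no ¬l = contradiction (Linked-resp (sym eq) (Linked-⁻¹ v)) ¬l
        ... | yes l with s , s∈S , su∈H ← covered u l
          = s ⁻¹ , inverse-closed s∈S , ∈H-resp
              (trans (sym (\\-leftDividesʳ s (s ∙ u))) (∙-congˡ (⁻¹-injective eq))) su∈H

      -- The greedy construction of the connection set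

      module _ (no4 : HasNoOrder4) where

        -- For x = vh the link gives x² ∈ H, so every odd power x^(2m+1) = v(hx^(2m)) stays in vH,
        -- and one of them squares to ε.
        involution : ∀ {v} → Linked v v → ∃[ k ] (k ∈ᴳ H × (v ∙ k) ∙ (v ∙ k) ≈ ε)
        involution {v} (h , h∈H , vhv∈H)
          with m , eq ← odd-power-squares-to-ε no4 (v ∙ h)
          = h ∙ x ^ (m * 2)
          , ∙∈H h∈H (∈H-resp (sym (^-^-assoc x 2 m)) (^∈H x²∈H m))
          , trans (∙-cong (sym (assoc v h _)) (sym (assoc v h _)))
              (trans (sym (x^2≈x∙x _)) eq)
          where
          x = v ∙ h
          x²∈H : x ^ 2 ∈ᴳ H
          x²∈H = ∈H-resp (trans (assoc _ _ _) (sym (x^2≈x∙x x))) (∙∈H vhv∈H h∈H)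

        cover : ∀ {S} → IsPartialTransversal S → ∀ v → ¬ v ∈ᴳ H → ¬ Covered S v →
          ∃[ S⁺ ] (IsPartialTransversal S⁺ × (∀ {w} → Covered S w → Covered S⁺ w) × Covered S⁺ v)
        cover {S} partial v v∉H v-free with Linked? v v
        ... | yes l with k , k∈H , yy≈ε ← involution l
          = S⁺ , S⁺-partial , Covered-mono , y , S⁺-intro (inj₂ (inj₁ refl)) , yv∈H
          where
          y = v ∙ k
          y≈y⁻¹ : y ≈ y ⁻¹
          y≈y⁻¹ = inverseˡ-unique y y yy≈ε
          y-free : ¬ Covered S y
          y-free = v-free ∘ Covered-∙ S k∈H
          -- As y = y⁻¹, adjoining it fills the single coset Hy = Hv⁻¹.
          open Extend partial (v∉H ∘ ∈-cancelʳ k∈H) y-free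
            (y-free ∘ Covered-resp S (sym y≈y⁻¹)) (λ _ → y≈y⁻¹)
          yv∈H : y ∙ v ∈ᴳ H
          yv∈H = ∈-cancelʳ k∈H (∈H-resp (sym (trans (assoc y v k) yy≈ε)) ε∈H)
        ... | no v-unlinked
          -- Such a u names a coset Hu⁻¹ inside HvH that `S` misses.
          with ∃? {P = λ u → Linked v u × ¬ Covered S u}
                 (λ x≈y (l , x-free) →
                    Linked-resp x≈y l , x-free ∘ Covered-resp S (sym x≈y))
                 (λ u → Linked? v u ×-dec ¬? (Covered? S u))
        ... | no none = contradiction (Counting.base-covered partial v covered) v-free
          where
          covered : ∀ u → Linked v u → Covered S u
          covered u l = decidable-stable (Covered? S u) (λ u-free → none (u , l , u-free))
        ... | yes (u , (h , h∈H , vhu∈H) , u-free)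
          = S⁺ , S⁺-partial , Covered-mono , s ⁻¹ , S⁺-intro (inj₂ (inj₂ refl)) , s⁻¹v∈H
          where
          -- Since vhu ∈ H, this s lies in Hu⁻¹, while s⁻¹ lies in Hv⁻¹: the pair fills both missing
          -- cosets.
          s = v ∙ h
          s⁻¹-free : ¬ Covered S (s ⁻¹)
          s⁻¹-free = u-free ∘ Covered-∙ S (⁻¹∈H vhu∈H) ∘ Covered-resp S (x⁻¹≈y∙[x∙y]⁻¹ s u)
          open Extend partial (v∉H ∘ ∈-cancelʳ h∈H) (v-free ∘ Covered-∙ S h∈H) s⁻¹-free
            -- From ss ∈ H would follow vhv ∈ H, linking v to itself, so `self` holds vacuously.
            (λ ss∈H → contradiction
              (h , h∈H , ∈-cancelʳ h∈H (∈H-resp (sym (assoc s v h)) ss∈H)) v-unlinked)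
          s⁻¹v∈H : s ⁻¹ ∙ v ∈ᴳ H
          s⁻¹v∈H = ∈-cancelʳ h∈H
            (∈H-resp (sym (trans (assoc (s ⁻¹) v h) (inverseˡ s))) ε∈H)

        ∅ : Subset G
        ∅ = (λ _ → false) , λ _ → ≡.refl

        ∅-partial : IsPartialTransversal ∅
        ∅-partial = record
          { inverse-closed = λ () ; disjoint = λ () ; unique = λ () }

        cover-all : ∀ xs → ∃[ S ] (IsPartialTransversal S × All (λ x → ¬ x ∈ᴳ H → Covered S x) xs)
        cover-all [] = ∅ , ∅-partial , []
        cover-all (x ∷ xs) with S , partial , covers ← cover-all xs
          with ∈-dec H x | Covered? S x
        ... | yes x∈H | _     = S , partial , contradiction x∈H ∷ covers
        ... | no _    | yes c = S , partial , (λ _ → c) ∷ covers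
        ... | no x∉H  | no x-free
          with S⁺ , partial⁺ , mono , x-covered ← cover partial x x∉H x-free
          = S⁺ , partial⁺ , (λ _ → x-covered) ∷ All.map (mono ∘_) covers

        transversal : ∃[ S ] (IsPartialTransversal S × (∀ v → ¬ v ∈ᴳ H → Covered S v))
        transversal with S , partial , covers ← cover-all (map E.from (allFin n))
          = S , partial , λ v v∉H → Covered-resp S (from∘to v)
              (All.lookup covers (∈-map⁺ E.from (∈-allFin (E.to v)))
                (v∉H ∘ ∈H-resp (from∘to v)))

        -- For v outside H, a neighbour c in H corresponds to the element cv⁻¹ of S ∩ Hv⁻¹, and this
        -- intersection has exactly one element.
        isPerfectCodeOf : IsPerfectCodeOf G H
        isPerfectCodeOf with S , partial , covers ← transversal
          = S , ((λ _ → inverse-closed) , λ ε∈S → disjoint ε∈S ε∈H) , independent , dominated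
          where
          open IsPartialTransversal partial
          independent : ∀ x y → x ∈ᴳ H → y ∈ᴳ H → ¬ Adj G S x y
          independent x y x∈H y∈H (_ , yx⁻¹∈S) = disjoint yx⁻¹∈S (∙∈H y∈H (⁻¹∈H x∈H))
          dominated : ∀ v → ¬ v ∈ᴳ H →
            ∃[ c ] (c ∈ᴳ H × Adj G S v c × (∀ c′ → c′ ∈ᴳ H → Adj G S v c′ → c′ ≈ c))
          dominated v v∉H with s , s∈S , sv∈H ← covers v v∉H
            = s ∙ v , sv∈H
            , ((λ v≈sv → v∉H (∈H-resp (sym v≈sv) sv∈H))
              , ∈-resp-≈ S (sym (//-rightDividesʳ v s)) s∈S)
            , nearest
            where
            nearest : ∀ c → c ∈ᴳ H → Adj G S v c → c ≈ s ∙ v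
            nearest c c∈H (_ , cv⁻¹∈S) = begin
              c                ≈⟨ //-rightDividesˡ v c ⟨
              (c ∙ v ⁻¹) ∙ v   ≈⟨ ∙-congʳ (unique cv⁻¹∈S (inverse-closed s∈S) cv⁻¹s⁻¹∈H) ⟩
              s ⁻¹ ⁻¹ ∙ v      ≈⟨ ∙-congʳ (⁻¹-involutive s) ⟩
              s ∙ v            ∎
              where
              cv⁻¹s⁻¹∈H : (c ∙ v ⁻¹) ∙ s ⁻¹ ∈ᴳ H
              cv⁻¹s⁻¹∈H = ∈H-resp
                (trans (∙-congˡ (⁻¹-anti-homo-∙ s v)) (sym (assoc _ _ _)))
                (∙∈H c∈H (⁻¹∈H sv∈H))

    -- The subgroup generated by the square of an element of order 4

    module _ {g : Carrier} (order4 : HasOrder G g 4) where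
      private
        g² = g ∙ g

        g≉ε : ¬ g ≈ ε
        g≉ε g≈ε = proj₂ order4 1 (s≤s z≤n) (s≤s (s≤s z≤n)) (trans (identityʳ g) g≈ε)

        ε≉g² : ¬ ε ≈ g²
        ε≉g² ε≈g² = proj₂ order4 2 (s≤s z≤n) (s≤s (s≤s (s≤s z≤n)))
          (trans (x^2≈x∙x g) (sym ε≈g²))

        g≉g² : ¬ g ≈ g²
        g≉g² g≈g² = g≉ε (identityʳ-unique g g (sym g≈g²))

        g²∙g²≈ε : g² ∙ g² ≈ ε
        g²∙g²≈ε = begin
          (g ∙ g) ∙ (g ∙ g)   ≈⟨ ∙-cong (x^2≈x∙x g) (x^2≈x∙x g) ⟨
          g ^ 2 ∙ g ^ 2       ≈⟨ ^-homo-+ g 2 2 ⟨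
          g ^ 4               ≈⟨ proj₁ order4 ⟩
          ε                   ∎

        P : Carrier → Set
        P x = x ≈ ε ⊎ x ≈ g²

        P? : Unary.Decidable P
        P? x = (x ≟ ε) ⊎-dec (x ≟ g²)

        P-resp : P Respects _≈_
        P-resp x≈y (inj₁ x≈ε)  = inj₁ (trans (sym x≈y) x≈ε)
        P-resp x≈y (inj₂ x≈g²) = inj₂ (trans (sym x≈y) x≈g²)

        P-∙ : ∀ {x y} → P x → P y → P (x ∙ y)
        P-∙ (inj₁ x≈ε)  q           = P-resp (sym (trans (∙-congʳ x≈ε) (identityˡ _))) q
        P-∙ p@(inj₂ _)  (inj₁ y≈ε)  = P-resp (sym (trans (∙-congˡ y≈ε) (identityʳ _))) p
        P-∙ (inj₂ x≈g²) (inj₂ y≈g²) = inj₁ (trans (∙-cong x≈g² y≈g²) g²∙g²≈ε)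

        P-⁻¹ : ∀ {x} → P x → P (x ⁻¹)
        P-⁻¹ (inj₁ x≈ε)  = inj₁ (trans (⁻¹-cong x≈ε) ε⁻¹≈ε)
        P-⁻¹ (inj₂ x≈g²) = inj₂ (trans (⁻¹-cong x≈g²) (sym (inverseˡ-unique g² g² g²∙g²≈ε)))

      ⟨g²⟩ : Subset G
      ⟨g²⟩ = ⟦ P? ⟧ P-resp

      private
        intro : ∀ {x} → P x → x ∈ᴳ ⟨g²⟩
        intro = ∈⟦⟧⁺ P? P-resp
        elim : ∀ {x} → x ∈ᴳ ⟨g²⟩ → P x
        elim = ∈⟦⟧⁻ P? P-resp

      ⟨g²⟩-isSubgroup : IsSubgroup G ⟨g²⟩
      ⟨g²⟩-isSubgroup = intro (inj₁ refl)
        , (λ _ _ x∈ y∈ → intro (P-∙ (elim x∈) (elim y∈)))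
        , (λ _ x∈ → intro (P-⁻¹ (elim x∈)))

      -- A neighbour of g in the subgroup puts g⁻¹ (if it is ε) or g (if it is g²) into S. Closure
      -- under inverses gives both, so ε and g² are distinct neighbours of g.
      ⟨g²⟩-notPerfectCode : ¬ IsPerfectCodeOf G ⟨g²⟩
      ⟨g²⟩-notPerfectCode (S , (inverse-closed , _) , _ , dominated)
        with c , c∈ , (_ , cg⁻¹∈S) , nearest ← dominated g ([ g≉ε , g≉g² ]′ ∘ elim)
        = ε≉g² (trans
            (nearest ε (intro (inj₁ refl))
              (g≉ε , ∈-resp-≈ S (sym (identityˡ _)) g⁻¹∈S))
            (sym (nearest g² (intro (inj₂ refl)) (g≉g² , ∈-resp-≈ S (sym g²g⁻¹≈g) g∈S))))
        where
        g²g⁻¹≈g : g² ∙ g ⁻¹ ≈ g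
        g²g⁻¹≈g = //-rightDividesʳ g g
        g∈S : g ∈ᴳ S
        g∈S with elim c∈
        ... | inj₁ c≈ε  = ∈-resp-≈ S (⁻¹-involutive g) (inverse-closed _
                            (∈-resp-≈ S (trans (∙-congʳ c≈ε) (identityˡ _)) cg⁻¹∈S))
        ... | inj₂ c≈g² = ∈-resp-≈ S (trans (∙-congʳ c≈g²) g²g⁻¹≈g) cg⁻¹∈S
        g⁻¹∈S : g ⁻¹ ∈ᴳ S
        g⁻¹∈S = inverse-closed g g∈S

theorem1p1 : (G : Group 0ℓ 0ℓ) → Finite G →
    CodePerfect G ⇔ (∀ g → ¬ HasOrder G g 4)
theorem1p1 G fin = mk⇔
  (λ perfect g order4 → ⟨g²⟩-notPerfectCode G fin order4
    (perfect (⟨g²⟩ G fin order4) (⟨g²⟩-isSubgroup G fin order4)))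
  (λ no4 H isSubgroup → isPerfectCodeOf G fin H isSubgroup no4)
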